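{- Let $\Sigma$ be a simple signed graph with maximum degree $\Delta(\Sigma)$. Then there is a linear oriented hypergraph $H$ with $\Lambda(H)=\Sigma$. Moreover, for every integer $k\ge\Delta(\Sigma)$ there exists a $k$-uniform linear oriented hypergraph $H_k$ with $\Lambda(H_k)=\Sigma$.
   Context: A hypergraph $(V,E,\mathcal I)$ consists of a finite set $V$ of vertices, a finite family $E=(e_\iota)_{\iota\in\Omega}$ of subsets of $V$ (the edges; an edge may be empty, and edges with different indices are regarded as different even if they coincide as sets) and its incidences $\mathcal I$. All hypergraphs are simple: each vertex $v\in e$ is incident with $e$ exactly once, so $\mathcal I=\{(v,e): v\in e\}$. A hypergraph is linear if $|e\cap f|\le 1$ for any two edges $e,f$ with distinct indices; it is $k$-uniform if every edge has exactly $k$ elements. An oriented hypergraph is a hypergraph together with a map $\sigma:\mathcal I\to\{+1,-1\}$; hypergraph terminology for an oriented hypergraph refers to its underlying hypergraph. Intersection graph: for a linear oriented hypergraph $G$, $\Lambda(G)$ is the ($2$-uniform linear) oriented hypergraph with vertex set $E(G)$ and one edge $ef=\{e,f\}$ for each pair of distinct $e,f\in E(G)$ with $e\cap f\ne\varnothing$; if $v\in e\cap f$ then $\sigma_{\Lambda(G)}(e,ef)=\sigma_G(v,e)$ and $\sigma_{\Lambda(G)}(f,ef)=\sigma_G(v,f)$. A simple signed graph $\Sigma=(\Gamma,\mathrm{sgn})$ is a finite graph $\Gamma$ without loops or multiple edges together with a map $\mathrm{sgn}:E(\Gamma)\to\{+1,-1\}$; $\Delta(\Sigma)$ is the maximum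 vertex degree of $\Gamma$. A $2$-uniform linear oriented hypergraph $(\Gamma,\beta)$ is regarded as an orientation of the signed graph on $\Gamma$ whose edge $e$ with endpoints $v_i,v_j$ has sign $\mathrm{sgn}(e)=-\beta(v_i,e)\beta(v_j,e)$. For an oriented hypergraph $H$, $\Lambda(H)=\Sigma$ means that $\Lambda(H)$ is an orientation of $\Sigma$: it has the same vertices and edges as $\Sigma$ (with edge $ef$ of $\Lambda(H)$ identified with the pair $\{e,f\}$ and edges of $H$ identified with vertices of $\Sigma$), and the induced edge signs are those of $\Sigma$. -}

module Defs where

open import Level using (0ℓ)
open import Data.Nat.Base using (ℕ; suc; _≤_; z≤n; s≤s)
open import Data.Nat.Properties using (≤-reflexive; ≤-<-trans; <⇒≱)
open import Data.Fin.Base using (Fin; zero; suc; _<_)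
open import Data.Fin.Properties using (_<?_; _≟_; <-irrefl; <-asym; suc-injective; 0≢1+n)
open import Data.Fin.Subset using (Subset; inside; outside; _∈_; _∩_; _∪_; _-_; ⊥; ⁅_⁆; ∣_∣; Nonempty)
open import Data.Fin.Subset.Properties
  using (nonempty?; x∈p∩q⁺; x∈p∩q⁻; x∈p∪q⁻; x∈⁅y⁆⇒x≡y; x∈p∧x≢y⇒x∈p-y; x∈p⇒∣p-x∣<∣p∣;
         Empty-unique; ∣⊥∣≡0; ∣⁅x⁆∣≡1; ∪-identityˡ; ∪-identityʳ)
open import Data.List.Base using (List; _∷_; length; lookup; allFin; map; filter; cartesianProduct)
open import Data.List.Extrema.Nat using (max)
open import Data.List.Membership.Propositional.Properties using (∈-filter⁻; ∈-lookup)
open import Data.List.Relation.Unary.All as All using ()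
open import Data.List.Relation.Unary.AllPairs using (_∷_)
open import Data.List.Relation.Unary.Unique.Propositional using (Unique)
open import Data.List.Relation.Unary.Unique.Propositional.Properties
  using (allFin⁺; filter⁺; cartesianProduct⁺)
open import Data.Product.Base using (_×_; _,_; proj₁; proj₂; ∃-syntax)
open import Data.Sign.Base using (Sign; opposite; _*_)
open import Data.Sum.Base using (_⊎_; inj₁; inj₂)
open import Data.Vec.Base as Vec using (here; there)
open import Function.Base using (_∘_)
open import Function.Bundles using (_↔_; _⇔_; Inverse)
open import Relation.Binary.Core using (Rel)
open import Relation.Binary.Definitions using (Symmetric; Decidable)
open import Relation.Binary.PropositionalEquality
  using (_≡_; _≢_; refl; sym; trans; cong; subst)
open import Relation.Nullary using (¬_; Dec; yes; no; contradiction; _×-dec_)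

-- Edges are an indexed family, so coinciding edges with different
-- indices are allowed.
record Hypergraph : Set where
  field
    order : ℕ
    size  : ℕ
    edge  : Fin size → Subset order

-- Proofs of v ∈ p are unique, so σ is a function on the set of incidences.
record OrientedHypergraph : Set where
  field
    hypergraph : Hypergraph
  open Hypergraph hypergraph public
  field
    σ : ∀ {v i} → v ∈ edge i → Sign

Linear : Hypergraph → Set
Linear H = ∀ {i j} → i ≢ j → ∣ edge i ∩ edge j ∣ ≤ 1
  where open Hypergraph H

Uniform : ℕ → Hypergraph → Set
Uniform k H = ∀ i → ∣ edge i ∣ ≡ k
  where open Hypergraph H

record LinearOrientedHypergraph : Set where
  field
    orientedHypergraph : OrientedHypergraph
  open OrientedHypergraph orientedHypergraph public
  field
    linear : Linear hypergraph

∣p∣≤1⁺ : ∀ {n} (p : Subset n) →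
         (∀ {x y} → x ∈ p → y ∈ p → x ≡ y) → ∣ p ∣ ≤ 1
∣p∣≤1⁺ Vec.[] _ = z≤n
∣p∣≤1⁺ (outside Vec.∷ p) eq = ∣p∣≤1⁺ p λ a b → suc-injective (eq (there a) (there b))
∣p∣≤1⁺ {suc n} (inside Vec.∷ p) eq = s≤s (≤-reflexive (trans (cong ∣_∣ p≡⊥) (∣⊥∣≡0 n)))
  where
  p≡⊥ : p ≡ ⊥
  p≡⊥ = Empty-unique λ (_ , a) → 0≢1+n (eq here (there a))

∣p∣≤1⁻ : ∀ {n} {x y : Fin n} (p : Subset n) →
         ∣ p ∣ ≤ 1 → x ∈ p → y ∈ p → x ≡ y
∣p∣≤1⁻ {x = x} {y} p ∣p∣≤1 x∈p y∈p with x ≟ y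
... | yes x≡y = x≡y
... | no x≢y = contradiction ∣p∣≤1 (<⇒≱ (≤-<-trans 1≤∣p-x∣ (x∈p⇒∣p-x∣<∣p∣ x∈p)))
  where
  1≤∣p-x∣ : 1 ≤ ∣ p - x ∣
  1≤∣p-x∣ = ≤-<-trans z≤n (x∈p⇒∣p-x∣<∣p∣ (x∈p∧x≢y⇒x∈p-y y∈p (x≢y ∘ sym)))

∣pair∣≡2 : ∀ {n} {i j : Fin n} → i ≢ j → ∣ ⁅ i ⁆ ∪ ⁅ j ⁆ ∣ ≡ 2
∣pair∣≡2 {i = zero} {zero} i≢j = contradiction refl i≢j
∣pair∣≡2 {i = zero} {suc j} _ =
  cong suc (trans (cong ∣_∣ (∪-identityˡ ⁅ j ⁆)) (∣⁅x⁆∣≡1 j))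
∣pair∣≡2 {i = suc i} {zero} _ =
  cong suc (trans (cong ∣_∣ (∪-identityʳ ⁅ i ⁆)) (∣⁅x⁆∣≡1 i))
∣pair∣≡2 {i = suc i} {suc j} i≢j = ∣pair∣≡2 (i≢j ∘ cong suc)

lookup-injective : ∀ {A : Set} {xs : List A} → Unique xs →
                   ∀ i j → lookup xs i ≡ lookup xs j → i ≡ j
lookup-injective (_ ∷ _) zero zero _ = refl
lookup-injective {xs = x ∷ xs} (x∉ ∷ _) zero (suc j) eq =
  contradiction eq (All.lookup x∉ (∈-lookup {xs = xs} j))
lookup-injective {xs = x ∷ xs} (x∉ ∷ _) (suc i) zero eq =
  contradiction (sym eq) (All.lookup x∉ (∈-lookup {xs = xs} i))
lookup-injective (_ ∷ u) (suc i) (suc j) eq = cong suc (lookup-injective u i j eq)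

∈pair : ∀ {n} {x i j : Fin n} → x ∈ ⁅ i ⁆ ∪ ⁅ j ⁆ → x ≡ i ⊎ x ≡ j
∈pair {i = i} {j} p with x∈p∪q⁻ ⁅ i ⁆ ⁅ j ⁆ p
... | inj₁ q = inj₁ (x∈⁅y⁆⇒x≡y i q)
... | inj₂ q = inj₂ (x∈⁅y⁆⇒x≡y j q)

ordered-pair : ∀ {n} {x y i j i′ j′ : Fin n} → i < j → i′ < j′ → x ≢ y →
               x ≡ i ⊎ x ≡ j → y ≡ i ⊎ y ≡ j → x ≡ i′ ⊎ x ≡ j′ → y ≡ i′ ⊎ y ≡ j′ →
               (i , j) ≡ (i′ , j′)
ordered-pair l l′ n (inj₁ refl) (inj₁ refl) _ _ = contradiction refl n
ordered-pair l l′ n (inj₂ refl) (inj₂ refl) _ _ = contradiction refl n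
ordered-pair l l′ n _ _ (inj₁ refl) (inj₁ refl) = contradiction refl n
ordered-pair l l′ n _ _ (inj₂ refl) (inj₂ refl) = contradiction refl n
ordered-pair l l′ n (inj₁ refl) (inj₂ refl) (inj₁ refl) (inj₂ refl) = refl
ordered-pair l l′ n (inj₂ refl) (inj₁ refl) (inj₂ refl) (inj₁ refl) = refl
ordered-pair l l′ n (inj₁ refl) (inj₂ refl) (inj₂ refl) (inj₁ refl) = contradiction l′ (<-asym l)
ordered-pair l l′ n (inj₂ refl) (inj₁ refl) (inj₁ refl) (inj₂ refl) = contradiction l′ (<-asym l)

∈-unique : ∀ {n} {x : Fin n} {p : Subset n} (a b : x ∈ p) → a ≡ b
∈-unique here here = refl
∈-unique (there a) (there b) = cong there (∈-unique a b)

module IntersectionGraph (G : LinearOrientedHypergraph) where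

  open LinearOrientedHypergraph G

  -- Each unordered pair {i , j} is represented once, with i < j.
  Crossing : Fin size × Fin size → Set
  Crossing (i , j) = i < j × Nonempty (edge i ∩ edge j)

  crossing? : ∀ ij → Dec (Crossing ij)
  crossing? (i , j) = (i <? j) ×-dec nonempty? (edge i ∩ edge j)

  crossings : List (Fin size × Fin size)
  crossings = filter crossing? (cartesianProduct (allFin size) (allFin size))

  Index : Set
  Index = Fin (length crossings)

  ends : Index → Fin size × Fin size
  ends c = lookup crossings c

  crosses : ∀ c → Crossing (ends c)
  crosses c = proj₂ (∈-filter⁻ crossing? {xs = cartesianProduct (allFin size) (allFin size)}
                       (∈-lookup {xs = crossings} c))

  Λ-edge : Index → Subset size
  Λ-edge c = ⁅ proj₁ (ends c) ⁆ ∪ ⁅ proj₂ (ends c) ⁆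

  -- By linearity this is the only element of the intersection.
  common : Index → Fin order
  common c = proj₁ (proj₂ (crosses c))

  common∈ : ∀ {e c} → e ∈ Λ-edge c → common c ∈ edge e
  common∈ {e} {c} e∈c
    with x∈p∩q⁻ (edge (proj₁ (ends c))) (edge (proj₂ (ends c))) (proj₂ (proj₂ (crosses c)))
       | ∈pair e∈c
  ... | v∈i , _ | inj₁ e≡i = subst (λ f → common c ∈ edge f) (sym e≡i) v∈i
  ... | _ , v∈j | inj₂ e≡j = subst (λ f → common c ∈ edge f) (sym e≡j) v∈j

  Λ-oriented : OrientedHypergraph
  Λ-oriented = record
    { hypergraph = record { order = size ; size = length crossings ; edge = Λ-edge }
    ; σ          = λ e∈c → σ (common∈ e∈c)
    }

  Λ-linear : Linear (OrientedHypergraph.hypergraph Λ-oriented)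
  Λ-linear {c} {d} c≢d = ∣p∣≤1⁺ (Λ-edge c ∩ Λ-edge d) same
    where
    unique : Unique crossings
    unique = filter⁺ crossing? (cartesianProduct⁺ (allFin⁺ size) (allFin⁺ size))
    same : ∀ {x y} → x ∈ Λ-edge c ∩ Λ-edge d → y ∈ Λ-edge c ∩ Λ-edge d → x ≡ y
    same {x} {y} x∈ y∈
      with x ≟ y | x∈p∩q⁻ (Λ-edge c) (Λ-edge d) x∈ | x∈p∩q⁻ (Λ-edge c) (Λ-edge d) y∈
    ... | yes x≡y | _ | _ = x≡y
    ... | no x≢y | x∈c , x∈d | y∈c , y∈d =
      contradiction
        (lookup-injective unique c d
          (ordered-pair (proj₁ (crosses c)) (proj₁ (crosses d)) x≢y
            (∈pair x∈c) (∈pair y∈c) (∈pair x∈d) (∈pair y∈d)))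
        c≢d

Λ : LinearOrientedHypergraph → LinearOrientedHypergraph
Λ G = record { orientedHypergraph = Λ-oriented ; linear = Λ-linear }
  where open IntersectionGraph G

Λ-uniform : ∀ G → Uniform 2 (LinearOrientedHypergraph.hypergraph (Λ G))
Λ-uniform G c = ∣pair∣≡2 λ i≡j → <-irrefl i≡j (proj₁ (crosses c))
  where open IntersectionGraph G

-- The sign of e in ef is read off at any vertex common to e and f.
Λ-σ : ∀ G → let open LinearOrientedHypergraph G; module L = LinearOrientedHypergraph (Λ G) in
      ∀ {c e f v} → e ≢ f → (e∈c : e ∈ L.edge c) → f ∈ L.edge c →
      (v∈e : v ∈ edge e) → v ∈ edge f → L.σ e∈c ≡ σ v∈e
Λ-σ G {c} {e} {f} {v} e≢f e∈c f∈c v∈e v∈f =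
  go (∣p∣≤1⁻ (edge e ∩ edge f) (linear e≢f)
        (x∈p∩q⁺ (common∈ e∈c , common∈ f∈c)) (x∈p∩q⁺ (v∈e , v∈f)))
     (common∈ e∈c)
  where
  open LinearOrientedHypergraph G
  open IntersectionGraph G
  go : ∀ {w} → w ≡ v → (w∈e : w ∈ edge e) → σ w∈e ≡ σ v∈e
  go refl w∈e = cong σ (∈-unique w∈e v∈e)

-- As sgn-sym holds for all proofs of adjacency, sgn depends only on
-- the unordered pair {u , v}.
record SignedGraph : Set₁ where
  infix 4 _~_ _~?_
  field
    order    : ℕ
    _~_      : Rel (Fin order) 0ℓ
    _~?_     : Decidable _~_
    ~-irrefl : ∀ {u} → ¬ (u ~ u)
    ~-sym    : Symmetric _~_
    sgn      : ∀ {u v} → u ~ v → Sign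
    sgn-sym  : ∀ {u v} (a : u ~ v) (b : v ~ u) → sgn a ≡ sgn b

  degree : Fin order → ℕ
  degree v = Vec.count (v ~?_) (Vec.allFin order)

  -- Equal to 0 for the graph with no vertices.
  Δ : ℕ
  Δ = max 0 (map degree (allFin order))

-- The edges of B and S are matched through their end vertices; this is a
-- bijection because B is 2-uniform and linear.
record _IsOrientationOf_ (B : LinearOrientedHypergraph) (S : SignedGraph) : Set where
  private
    module B = LinearOrientedHypergraph B
    module S = SignedGraph S
  field
    uniform  : Uniform 2 B.hypergraph
    vertices : Fin B.order ↔ Fin S.order
  open Inverse vertices using (to)
  field
    edges : ∀ {u v} → (∃[ i ] B.edge i ≡ ⁅ u ⁆ ∪ ⁅ v ⁆) ⇔ to u S.~ to v
    signs : ∀ {i u v} (u∈i : u ∈ B.edge i) (v∈i : v ∈ B.edge i) (a : to u S.~ to v) →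
            S.sgn a ≡ opposite (B.σ u∈i * B.σ v∈i)

{-# OPTIONS --safe #-}
-- Take the edges of Σ as vertices of H and turn each vertex e of Σ into the
-- set of edges of Σ at e.  Two such sets meet exactly when their vertices are
-- adjacent, and then only in the edge joining them.  Adding k ∸ deg e private
-- vertices to the set of e makes H k-uniform without changing intersections.
module Submission where

open import Defs
open import Data.Nat.Base using (ℕ; _≤_)
open import Data.Product.Base using (_×_; ∃-syntax)
open import Data.Bool.Base using (true; false)
open import Data.Fin.Base using (Fin; zero; suc; _<_; combine; remQuot; inject≤)
open import Data.Fin.Properties
  using (_<?_; _≟_; <-cmp; <-asym; <-irrefl; suc-injective; remQuot-combine; combine-injectiveʳ;
         inject≤-injective)
open import Data.Fin.Subset using (Subset; inside; outside; _∈_; _∉_; _∩_; _∪_; ⁅_⁆; ∣_∣; ⋃)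
open import Data.Fin.Subset.Properties
  using (x∈p∩q⁺; x∈p∩q⁻; x∈p∪q⁺; x∈p∪q⁻; x∈⁅x⁆; x∈⁅y⁆⇒x≡y; ∉⊥; ∣⊥∣≡0; ∪-identityˡ; ∪-comm)
open import Data.List.Base using (List; []; _∷_; _++_; length; map; filter; allFin; tabulate)
open import Data.List.Extrema.Nat using (xs≤max)
open import Data.List.Membership.Propositional using () renaming (_∈_ to _∈ˡ_)
open import Data.List.Membership.Propositional.Properties
  using (∈-allFin; ∈-map⁺; ∈-map⁻; ∈-filter⁺; ∈-filter⁻; ∈-++⁺ˡ; ∈-++⁻; ∈-cartesianProduct⁺)
open import Data.List.Properties using (length-++; length-map; length-tabulate)
open import Data.List.Relation.Binary.Disjoint.Propositional using (Disjoint)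
open import Data.List.Relation.Unary.All as All using ()
open import Data.List.Relation.Unary.AllPairs using ([]; _∷_)
open import Data.List.Relation.Unary.Any using (here; there; index)
open import Data.List.Relation.Unary.Any.Properties using (lookup-index)
open import Data.List.Relation.Unary.Unique.Propositional using (Unique)
open import Data.List.Relation.Unary.Unique.Propositional.Properties
  using (allFin⁺; filter⁺; map⁺; ++⁺)
open import Data.Nat.Base using (suc; _+_; _∸_) renaming (_*_ to _*ℕ_)
open import Data.Nat.Properties using (m+[n∸m]≡n; m∸n≤m; ≤-refl; ≤-trans)
open import Data.Product.Base using (_,_; proj₁; proj₂; uncurry)
open import Data.Sign.Base using (Sign; opposite; _*_) renaming (+ to ⊕)
open import Data.Sign.Properties using (opposite-involutive; *-identityʳ; *-comm)
open import Data.Sum.Base using (_⊎_; inj₁; inj₂)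
open import Data.Vec.Base as Vec using (here; there)
open import Function.Base using (_∘_; id)
open import Function.Bundles using (mk⇔)
open import Function.Construct.Identity using (↔-id)
open import Level using (Level)
open import Relation.Binary.Definitions using (tri<; tri≈; tri>)
open import Relation.Binary.PropositionalEquality
  using (_≡_; _≢_; refl; sym; trans; cong; cong₂; subst; module ≡-Reasoning)
open import Relation.Nullary using (yes; no; contradiction; does)
open import Relation.Unary using (Pred; Decidable)

-- Finite subsets given by lists.

∣⁅x⁆∪p∣≡1+∣p∣ : ∀ {n} {x : Fin n} {p : Subset n} → x ∉ p → ∣ ⁅ x ⁆ ∪ p ∣ ≡ suc ∣ p ∣
∣⁅x⁆∪p∣≡1+∣p∣ {x = zero} {inside Vec.∷ p} x∉p = contradiction here x∉p
∣⁅x⁆∪p∣≡1+∣p∣ {x = zero} {outside Vec.∷ p} x∉p = cong (suc ∘ ∣_∣) (∪-identityˡ p)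
∣⁅x⁆∪p∣≡1+∣p∣ {x = suc x} {inside Vec.∷ p} x∉p = cong suc (∣⁅x⁆∪p∣≡1+∣p∣ (x∉p ∘ there))
∣⁅x⁆∪p∣≡1+∣p∣ {x = suc x} {outside Vec.∷ p} x∉p = ∣⁅x⁆∪p∣≡1+∣p∣ (x∉p ∘ there)

fromList : ∀ {n} → List (Fin n) → Subset n
fromList = ⋃ ∘ map ⁅_⁆

∈-fromList⁺ : ∀ {n} {x : Fin n} {xs} → x ∈ˡ xs → x ∈ fromList xs
∈-fromList⁺ {x = x} (here refl) = x∈p∪q⁺ (inj₁ (x∈⁅x⁆ x))
∈-fromList⁺ (there x∈xs) = x∈p∪q⁺ (inj₂ (∈-fromList⁺ x∈xs))

∈-fromList⁻ : ∀ {n} {x : Fin n} xs → x ∈ fromList xs → x ∈ˡ xs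
∈-fromList⁻ [] x∈ = contradiction x∈ ∉⊥
∈-fromList⁻ (y ∷ xs) x∈ with x∈p∪q⁻ ⁅ y ⁆ (fromList xs) x∈
... | inj₁ x∈⁅y⁆ = here (x∈⁅y⁆⇒x≡y y x∈⁅y⁆)
... | inj₂ x∈xs = there (∈-fromList⁻ xs x∈xs)

∣fromList∣ : ∀ {n} {xs : List (Fin n)} → Unique xs → ∣ fromList xs ∣ ≡ length xs
∣fromList∣ {n} [] = ∣⊥∣≡0 n
∣fromList∣ {xs = x ∷ xs} (x≢ ∷ xs!) =
  trans (∣⁅x⁆∪p∣≡1+∣p∣ λ x∈ → All.lookup x≢ (∈-fromList⁻ xs x∈) refl) (cong suc (∣fromList∣ xs!))

-- Links the neighbour list in `ends-at` to `degree`, which is a `Vec.count`.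
length-filter-tabulate : ∀ {a p : Level} {A : Set a} {P : Pred A p} (P? : Decidable P) {n}
                         (f : Fin n → A) → length (filter P? (tabulate f)) ≡ Vec.count P? (Vec.tabulate f)
length-filter-tabulate P? {ℕ.zero} f = refl
length-filter-tabulate P? {suc n} f with does (P? (f zero))
... | true = cong suc (length-filter-tabulate P? (f ∘ suc))
... | false = length-filter-tabulate P? (f ∘ suc)

-- Unordered pairs, encoded as sorted pairs.

ordered : ∀ {n} → Fin n → Fin n → Fin n × Fin n
ordered u v with u <? v
... | yes _ = u , v
-- For `u ≡ v` this yields the diagonal pair, which later marks private vertices.
... | no _ = v , u

ordered-< : ∀ {n} {u v : Fin n} → u < v → ordered u v ≡ (u , v)
ordered-< {u = u} {v} u<v with u <? v
... | yes _ = refl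
... | no u≮v = contradiction u<v u≮v

ordered-comm : ∀ {n} (u v : Fin n) → ordered u v ≡ ordered v u
ordered-comm u v with u <? v | v <? u | <-cmp u v
... | yes _ | no _ | _ = refl
... | no _ | yes _ | _ = refl
... | yes u<v | yes v<u | _ = contradiction v<u (<-asym u<v)
... | no u≮v | no v≮u | tri< u<v _ _ = contradiction u<v u≮v
... | no u≮v | no v≮u | tri≈ _ refl _ = refl
... | no u≮v | no v≮u | tri> _ _ v<u = contradiction v<u v≮u

-- The common pair contains the distinct elements `u` and `u′`, so it consists of exactly these two.
ordered-injective : ∀ {n} {u v u′ v′ : Fin n} → u ≢ u′ → ordered u v ≡ ordered u′ v′ →
                    v ≡ u′ × v′ ≡ u
ordered-injective {u = u} {v} {u′} {v′} u≢u′ eq with u <? v | u′ <? v′ | eq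
... | yes _ | yes _ | refl = contradiction refl u≢u′
... | yes _ | no _ | refl = refl , refl
... | no _ | yes _ | refl = refl , refl
... | no _ | no _ | refl = contradiction refl u≢u′

ordered-injectiveʳ : ∀ {n} {u v v′ : Fin n} → ordered u v ≡ ordered u v′ → v ≡ v′
ordered-injectiveʳ {u = u} {v} {v′} eq with u <? v | u <? v′ | eq
... | yes _ | yes _ | refl = refl
... | yes _ | no _ | refl = refl
... | no _ | yes _ | refl = refl
... | no _ | no _ | refl = refl

-- The vertices of `H`.

module Construction (S : SignedGraph) (k : ℕ) (Δ≤k : SignedGraph.Δ S ≤ k) where

  open SignedGraph S

  degree≤k : ∀ v → degree v ≤ k
  degree≤k v =
    ≤-trans (All.lookup (xs≤max 0 (map degree (allFin order))) (∈-map⁺ degree (∈-allFin v))) Δ≤k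

  -- Codes of a pair with a label. Label 0 is for edges; the other `k` labels suffice because no
  -- star is padded by more than `k` vertices.
  Vertex : Set
  Vertex = Fin ((order *ℕ order) *ℕ suc k)

  -- vertex u v zero is the edge uv of S, and vertex u u (suc t) is the
  -- t-th private vertex of u; the remaining ones are isolated.
  vertex : Fin order → Fin order → Fin (suc k) → Vertex
  vertex u v t = combine (uncurry combine (ordered u v)) t

  pair : Vertex → Fin order × Fin order
  pair x = remQuot order (proj₁ (remQuot {order *ℕ order} (suc k) x))

  pair-vertex : ∀ u v t → pair (vertex u v t) ≡ ordered u v
  pair-vertex u v t =
    trans (cong (remQuot order ∘ proj₁) (remQuot-combine (uncurry combine (ordered u v)) t))
          (remQuot-combine (proj₁ (ordered u v)) (proj₂ (ordered u v)))

  vertex-comm : ∀ u v t → vertex u v t ≡ vertex v u t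
  vertex-comm u v t = cong (λ p → combine (uncurry combine p) t) (ordered-comm u v)

  vertex-injective-pair : ∀ u v t u′ v′ t′ → vertex u v t ≡ vertex u′ v′ t′ →
                          ordered u v ≡ ordered u′ v′
  vertex-injective-pair u v t u′ v′ t′ eq =
    trans (sym (pair-vertex u v t)) (trans (cong pair eq) (pair-vertex u′ v′ t′))

  vertex-injectiveˡ : ∀ {u u′} v t v′ t′ → u ≢ u′ → vertex u v t ≡ vertex u′ v′ t′ →
                      v ≡ u′ × v′ ≡ u
  vertex-injectiveˡ {u} {u′} v t v′ t′ u≢u′ =
    ordered-injective u≢u′ ∘ vertex-injective-pair u v t u′ v′ t′

  vertex-injectiveʳ : ∀ u v t v′ t′ → vertex u v t ≡ vertex u v′ t′ → v ≡ v′
  vertex-injectiveʳ u v t v′ t′ = ordered-injectiveʳ {u = u} ∘ vertex-injective-pair u v t u v′ t′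

  vertex-injective-label : ∀ u v t u′ v′ t′ → vertex u v t ≡ vertex u′ v′ t′ → t ≡ t′
  vertex-injective-label u v t u′ v′ t′ =
    combine-injectiveʳ (uncurry combine (ordered u v)) t (uncurry combine (ordered u′ v′)) t′

  -- The edges of `H` as stars.

  ends-at : Fin order → List Vertex
  ends-at u = map (λ v → vertex u v zero) (filter (u ~?_) (allFin order))

  ∈-ends-at⁺ : ∀ {u v} → u ~ v → vertex u v zero ∈ˡ ends-at u
  ∈-ends-at⁺ {u} {v} u~v = ∈-map⁺ _ (∈-filter⁺ (u ~?_) (∈-allFin v) u~v)

  ∈-ends-at⁻ : ∀ {u x} → x ∈ˡ ends-at u → ∃[ v ] u ~ v × x ≡ vertex u v zero
  ∈-ends-at⁻ {u} x∈ with v , v∈ , eq ← ∈-map⁻ _ x∈ =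
    v , proj₂ (∈-filter⁻ (u ~?_) {xs = allFin order} v∈) , eq

  private-vertex : ∀ u → Fin (k ∸ degree u) → Vertex
  private-vertex u t = vertex u u (suc (inject≤ t (m∸n≤m k (degree u))))

  private-vertices : Fin order → List Vertex
  private-vertices u = map (private-vertex u) (allFin (k ∸ degree u))

  star : Fin order → List Vertex
  star u = ends-at u ++ private-vertices u

  -- Within the star of `u`, the pair determines the neighbour and the label determines the private
  -- vertex; the two parts are separated by label zero against a successor.
  star-unique : ∀ u → Unique (star u)
  star-unique u =
    ++⁺ (map⁺ (vertex-injectiveʳ u _ zero _ zero) (filter⁺ (u ~?_) (allFin⁺ order)))
        (map⁺ (inject≤-injective _ _ _ _ ∘ suc-injective ∘ vertex-injective-label u u _ u u _) (allFin⁺ _))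
        disjoint
    where
    disjoint : Disjoint (ends-at u) (private-vertices u)
    disjoint (x∈ends , x∈private)
      with v , _ , refl ← ∈-ends-at⁻ {u} x∈ends
         | _ , _ , eq ← ∈-map⁻ (private-vertex u) x∈private
      = contradiction (vertex-injective-label u v zero u u _ eq) λ ()

  length-star : ∀ u → length (star u) ≡ k
  length-star u = begin
    length (star u)                                    ≡⟨ length-++ (ends-at u) ⟩
    length (ends-at u) + length (private-vertices u)   ≡⟨ cong₂ _+_ length-ends length-private ⟩
    -- Here `Δ≤k` enters: it makes the truncated subtraction exact.
    degree u + (k ∸ degree u)                          ≡⟨ m+[n∸m]≡n (degree≤k u) ⟩
    k                                                  ∎
    where
    open ≡-Reasoning
    length-ends : length (ends-at u) ≡ degree u
    length-ends = trans (length-map _ (filter (u ~?_) (allFin order)))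
                        (length-filter-tabulate (u ~?_) id)
    length-private : length (private-vertices u) ≡ k ∸ degree u
    length-private = trans (length-map _ (allFin (k ∸ degree u))) (length-tabulate id)

  edge : Fin order → Subset ((order *ℕ order) *ℕ suc k)
  edge u = fromList (star u)

  ∣edge∣≡k : ∀ u → ∣ edge u ∣ ≡ k
  ∣edge∣≡k u = trans (∣fromList∣ (star-unique u)) (length-star u)

  -- The label of a private vertex is left arbitrary, since its diagonal pair alone keeps it out of
  -- other stars.
  ∈-edge⁻ : ∀ {u x} → x ∈ edge u →
            (∃[ v ] u ~ v × x ≡ vertex u v zero) ⊎ (∃[ t ] x ≡ vertex u u t)
  ∈-edge⁻ {u} x∈ with ∈-++⁻ (ends-at u) (∈-fromList⁻ (star u) x∈)
  ... | inj₁ x∈ends = inj₁ (∈-ends-at⁻ {u} x∈ends)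
  ... | inj₂ x∈private with _ , _ , eq ← ∈-map⁻ (private-vertex u) x∈private = inj₂ (_ , eq)

  vertex∈edge : ∀ {u v} → u ~ v → vertex u v zero ∈ edge u
  vertex∈edge u~v = ∈-fromList⁺ (∈-++⁺ˡ (∈-ends-at⁺ u~v))

  -- The pair of a common vertex contains both `u` and `v`, so it is not diagonal and the vertex is
  -- the edge joining them. This gives linearity of `H`, adjacency in `Λ H` and the location of
  -- `common`.
  edge∩edge : ∀ {u v x} → u ≢ v → x ∈ edge u → x ∈ edge v → u ~ v × x ≡ vertex u v zero
  edge∩edge {u} {v} u≢v x∈u x∈v with ∈-edge⁻ {u} x∈u | ∈-edge⁻ {v} x∈v
  ... | inj₂ (t , refl) | inj₁ (w , _ , eq) =
    contradiction (proj₁ (vertex-injectiveˡ u t w zero u≢v eq)) u≢v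
  ... | inj₂ (t , refl) | inj₂ (t′ , eq) =
    contradiction (proj₁ (vertex-injectiveˡ u t v t′ u≢v eq)) u≢v
  ... | inj₁ (w , _ , refl) | inj₂ (t , eq) =
    contradiction (sym (proj₂ (vertex-injectiveˡ w zero v t u≢v eq))) u≢v
  ... | inj₁ (w , u~w , refl) | inj₁ (w′ , _ , eq)
    with refl , _ ← vertex-injectiveˡ w zero w′ zero u≢v eq = u~w , refl

  -- Edge signs and the orientation of `H`.

  weight : Fin order → Fin order → Sign
  weight u v with u ~? v
  ... | yes u~v = sgn u~v
  -- A default for nonadjacent pairs, diagonal ones included, so that `endSign` can be computed from
  -- a pair without an adjacency proof.
  ... | no _ = ⊕

  weight≡sgn : ∀ {u v} (u~v : u ~ v) → weight u v ≡ sgn u~v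
  weight≡sgn {u} {v} u~v with u ~? v
  -- `sgn-sym` compares proofs in opposite directions, so two proofs of `u ~ v` are compared through
  -- a proof of `v ~ u`.
  ... | yes a = trans (sgn-sym a (~-sym a)) (sym (sgn-sym u~v (~-sym a)))
  ... | no u≁v = contradiction u~v u≁v

  -- The vertex uv of H, where u < v, carries the whole sign at its incidence with u.
  endSign : Fin order → Fin order × Fin order → Sign
  endSign w (u , v) with w ≟ u
  ... | yes _ = opposite (weight u v)
  ... | no _ = ⊕

  σ : Fin order → Vertex → Sign
  σ u x = endSign u (pair x)

  -- The factor at the larger end is `⊕`. The `opposite` matches the minus sign in the rule for the
  -- sign of an oriented edge.
  endSign-product : ∀ {u v} → u < v →
                    endSign u (u , v) * endSign v (u , v) ≡ opposite (weight u v)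
  endSign-product {u} {v} u<v with u ≟ u | v ≟ u
  ... | no u≢u | _ = contradiction refl u≢u
  ... | yes _ | yes v≡u = contradiction u<v (<-irrefl (sym v≡u))
  ... | yes _ | no _ = *-identityʳ _

  σ-product-< : ∀ {u v x} → u < v → pair x ≡ (u , v) → (u~v : u ~ v) →
                σ u x * σ v x ≡ opposite (sgn u~v)
  σ-product-< {u} {v} u<v pair≡ u~v =
    trans (cong (λ p → endSign u p * endSign v p) pair≡)
      (trans (endSign-product u<v) (cong opposite (weight≡sgn u~v)))

  σ-product : ∀ {u v} (u~v : u ~ v) →
              σ u (vertex u v zero) * σ v (vertex u v zero) ≡ opposite (sgn u~v)
  σ-product {u} {v} u~v with <-cmp u v
  ... | tri≈ _ refl _ = contradiction u~v ~-irrefl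
  ... | tri< u<v _ _ =
    σ-product-< {x = vertex u v zero} u<v (trans (pair-vertex u v zero) (ordered-< u<v)) u~v
  -- The stored pair is now `(v , u)`, so the ends are exchanged before the sorted case applies.
  ... | tri> _ _ v<u = begin
    σ u x * σ v x              ≡⟨ *-comm (σ u x) (σ v x) ⟩
    σ v x * σ u x              ≡⟨ σ-product-< {x = x} v<u pair-x (~-sym u~v) ⟩
    opposite (sgn (~-sym u~v)) ≡⟨ cong opposite (sgn-sym (~-sym u~v) u~v) ⟩
    opposite (sgn u~v)         ∎
    where
    open ≡-Reasoning
    x = vertex u v zero
    pair-x : pair x ≡ (v , u)
    pair-x = trans (pair-vertex u v zero) (trans (ordered-comm u v) (ordered-< v<u))

  H : LinearOrientedHypergraph
  H = record
    { orientedHypergraph = record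
      { hypergraph = record { edge = edge }
      ; σ          = λ {x} {u} _ → σ u x
      }
    ; linear = λ {u} {v} u≢v → ∣p∣≤1⁺ (edge u ∩ edge v) λ x∈ y∈ →
        trans (common≡ u≢v x∈) (sym (common≡ u≢v y∈))
    }
    where
    common≡ : ∀ {u v x} → u ≢ v → x ∈ edge u ∩ edge v → x ≡ vertex u v zero
    common≡ {u} {v} u≢v x∈ with x∈u , x∈v ← x∈p∩q⁻ (edge u) (edge v) x∈ =
      proj₂ (edge∩edge u≢v x∈u x∈v)

  -- The intersection graph of `H`.

  open IntersectionGraph H

  -- If `u` and `v` coincided, both ends of the crossing would lie in one singleton, although the
  -- first is strictly smaller.
  ends-distinct : ∀ {c u v} → Λ-edge c ≡ ⁅ u ⁆ ∪ ⁅ v ⁆ → u ≢ v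
  ends-distinct {c} {u} eq refl =
    <-irrefl (trans (≡u (inj₁ (x∈⁅x⁆ _))) (sym (≡u (inj₂ (x∈⁅x⁆ _))))) (proj₁ (crosses c))
    where
    ≡u : ∀ {w} → w ∈ ⁅ proj₁ (ends c) ⁆ ⊎ w ∈ ⁅ proj₂ (ends c) ⁆ → w ≡ u
    ≡u {w} w∈ with ∈pair {i = u} {u} (subst (w ∈_) eq (x∈p∪q⁺ w∈))
    ... | inj₁ w≡u = w≡u
    ... | inj₂ w≡u = w≡u

  Λ-adjacent : ∀ {c u v} → Λ-edge c ≡ ⁅ u ⁆ ∪ ⁅ v ⁆ → u ~ v
  Λ-adjacent {c} {u} {v} eq =
    proj₁ (edge∩edge (ends-distinct {c} eq)
      (common∈ {c = c} (subst (u ∈_) (sym eq) (x∈p∪q⁺ (inj₁ (x∈⁅x⁆ u)))))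
      (common∈ {c = c} (subst (v ∈_) (sym eq) (x∈p∪q⁺ (inj₂ (x∈⁅x⁆ v))))))

  -- The stars of `u` and `v` share the vertex `uv`, so the pair passes the filter; crossings are
  -- listed in increasing order, hence the restriction to `u < v`.
  Λ-edge-<⁺ : ∀ {u v} → u < v → u ~ v → ∃[ c ] Λ-edge c ≡ ⁅ u ⁆ ∪ ⁅ v ⁆
  Λ-edge-<⁺ {u} {v} u<v u~v =
    index uv∈ , cong (λ p → ⁅ proj₁ p ⁆ ∪ ⁅ proj₂ p ⁆) (sym (lookup-index uv∈))
    where
    uv∈ : (u , v) ∈ˡ crossings
    uv∈ = ∈-filter⁺ crossing? (∈-cartesianProduct⁺ (∈-allFin u) (∈-allFin v))
      (u<v , vertex u v zero , x∈p∩q⁺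
        ( vertex∈edge u~v
        , subst (_∈ edge v) (vertex-comm v u zero) (vertex∈edge (~-sym u~v))))

  Λ-edge⁺ : ∀ {u v} → u ~ v → ∃[ c ] Λ-edge c ≡ ⁅ u ⁆ ∪ ⁅ v ⁆
  Λ-edge⁺ {u} {v} u~v with <-cmp u v
  ... | tri≈ _ refl _ = contradiction u~v ~-irrefl
  ... | tri< u<v _ _ = Λ-edge-<⁺ u<v u~v
  ... | tri> _ _ v<u with c , eq ← Λ-edge-<⁺ v<u (~-sym u~v) = c , trans eq (∪-comm ⁅ v ⁆ ⁅ u ⁆)

  -- `common c` is whichever witness the search found, but it lies in both stars and so must be the
  -- vertex `uv`, where the product of incidence signs is known.
  Λ-signs : ∀ {c u v} → u ∈ Λ-edge c → v ∈ Λ-edge c → (u~v : u ~ v) →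
            sgn u~v ≡ opposite (σ u (common c) * σ v (common c))
  Λ-signs {c} {u} {v} u∈c v∈c u~v = begin
    sgn u~v                                        ≡⟨ opposite-involutive _ ⟨
    opposite (opposite (sgn u~v))                  ≡⟨ cong opposite (σ-product u~v) ⟨
    opposite (σ u (vertex u v zero) * σ v (vertex u v zero))
      ≡⟨ cong (λ x → opposite (σ u x * σ v x)) common≡ ⟨
    opposite (σ u (common c) * σ v (common c))     ∎
    where
    open ≡-Reasoning
    common≡ : common c ≡ vertex u v zero
    common≡ = proj₂ (edge∩edge (λ { refl → ~-irrefl u~v })
                       (common∈ {c = c} u∈c) (common∈ {c = c} v∈c))

  isOrientation : Λ H IsOrientationOf S
  isOrientation = record
    { uniform  = Λ-uniform H
    ; vertices = ↔-id _
    ; edges    = mk⇔ (λ (c , eq) → Λ-adjacent {c} eq) Λ-edge⁺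
    ; signs    = λ {c} → Λ-signs {c}
    }

theorem3p6 : (S : SignedGraph) →
    (∃[ H ] Λ H IsOrientationOf S) ×
    (∀ (k : ℕ) → SignedGraph.Δ S ≤ k →
    ∃[ H ] Uniform k (LinearOrientedHypergraph.hypergraph H) × Λ H IsOrientationOf S)
theorem3p6 S = (H , isOrientation) , λ k Δ≤k →
    Construction.H S k Δ≤k , Construction.∣edge∣≡k S k Δ≤k , Construction.isOrientation S k Δ≤k
  -- The first claim is the case where `k` is the maximum degree.
  where open Construction S (SignedGraph.Δ S) ≤-refl
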